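{- There is an absolute constant $c>0$ such that for all integers $k\ge 1$, all integers $n\ge 3k$ and all integers $\ell\ge 4$, $$r_k(n;\ell)>t_k(cn).$$ In particular, the four-color Ramsey number satisfies $r_k(n;4)>t_k(cn)$ for all $k$ and all $n\ge 3k$.
   Context: $r_k(n;\ell)$ denotes the minimum $N$ such that every coloring of the $k$-element subsets of an $N$-element set with $\ell$ colors contains a monochromatic subset of size $n$, i.e. a subset of size $n$ all of whose $k$-element subsets have the same color. The tower function $t_k(x)$ is defined by $t_1(x)=x$ and $t_{i+1}(x)=2^{t_i(x)}$. The constant $c$ does not depend on $k$, $n$ or $\ell$. -}

module Defs where

open import Algebra.Definitions.RawSemiring using (_^_)
open import Data.Fin.Base using (Fin)
open import Data.Fin.Subset using (Subset; ∣_∣; _⊆_)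
open import Data.Integer.Base using (ℤ; +_; -[1+_])
open import Data.Nat.Base using (ℕ; zero; suc; NonZero; _≤_)
open import Data.Product.Base using (Σ-syntax; ∃-syntax; _×_; proj₁)
open import Data.Rational.Base
  using (ℚ; 0ℚ; ½; _/_; _<_; ↥_; ↧ₙ_; +-*-rawSemiring)
open import Relation.Binary.PropositionalEquality using (_≡_)

_-Subset_ : ℕ → ℕ → Set
k -Subset N = Σ[ S ∈ Subset N ] ∣ S ∣ ≡ k

Coloring : (k N ℓ : ℕ) → Set
Coloring k N ℓ = k -Subset N → Fin ℓ

Monochromatic : ∀ {k N ℓ} → Coloring k N ℓ → Subset N → Set
Monochromatic {k} {N} χ A =
  ∀ (S T : k -Subset N) → proj₁ S ⊆ A → proj₁ T ⊆ A → χ S ≡ χ T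

RamseyProperty : (k n ℓ N : ℕ) → Set
RamseyProperty k n ℓ N =
  ∀ (χ : Coloring k N ℓ) → ∃[ A ] ∣ A ∣ ≡ n × Monochromatic χ A

-- "N = r_k(n;ℓ)".  The Ramsey number is given as a relation (at most one N
-- satisfies it), so that Ramsey's theorem is not needed to define it.
IsRamseyNumber : (k n ℓ N : ℕ) → Set
IsRamseyNumber k n ℓ N =
  RamseyProperty k n ℓ N × (∀ M → RamseyProperty k n ℓ M → N ≤ M)

fromℕ : ℕ → ℚ
fromℕ n = + n / 1

-- The values of the tower function at rational arguments are in general
-- irrational.  A real number x is represented by its strict upper cut
-- { q ∈ ℚ ∣ x < q }.
Cut : Set₁
Cut = ℚ → Set

infix 4 _<ᶜ_
_<ᶜ_ : Cut → ℚ → Set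
x <ᶜ q = x q

fromℚ : ℚ → Cut
fromℚ p q = p < q

2^ℤ : ℤ → ℚ
2^ℤ (+ m)    = _^_ +-*-rawSemiring (fromℕ 2) m
2^ℤ -[1+ m ] = _^_ +-*-rawSemiring ½ (suc m)

-- 2^s < q for a rational s = a / b with b > 0: for positive q this is
-- 2^a < q^b.  Positivity is required separately because of even b.
2^_<ℚ_ : ℚ → ℚ → Set
2^ s <ℚ q = 0ℚ < q × 2^ℤ (↥ s) < _^_ +-*-rawSemiring q (↧ₙ s)

-- 2^x = inf { 2^s ∣ s ∈ ℚ, x < s }.
2^ᶜ_ : Cut → Cut
(2^ᶜ x) q = ∃[ s ] x <ᶜ s × 2^ s <ℚ q

tower : (k : ℕ) → .{{NonZero k}} → Cut → Cut
tower (suc zero)    x = x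
tower (suc (suc i)) x = 2^ᶜ tower (suc i) x

{-# OPTIONS --safe #-}
module Submission where

-- The stepping-up of Erdős and Hajnal, sharpened as by Conlon, Fox and Sudakov.  For
-- x₁ < ... < x_{k+1} < 2^N let δᵢ be the most significant binary digit in which xᵢ and x_{i+1}
-- differ.  If the δᵢ are monotone, the tuple gets the colour of {δᵢ}; otherwise its colour records
-- whether the δᵢ start by rising, and the parity of the position of the first turn.  Consider the
-- δ-sequence of a monochromatic set.  Windows of it shifted by one see the same turn at positions
-- of different parity, so the first turn is the second or the last but one term; since two
-- consecutive turns have opposite directions, there is no further turn if it is the second.  Hence
-- the sequence is monotone up to one term at an end, and the size of a largest monochromatic set
-- grows by at most 2 if k ≥ 4.  If k = 3, only the directions matter and the size may double.  If
-- k = 2, the starting graph colouring (from the union bound) uses two colours, so that the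
-- direction can be recorded next to the colour of a monotone pair.  As n ≥ 3k, losing 2k in total
-- leaves a graph problem of size linear in n.

open import Defs
import Algebra.Definitions.RawSemiring as RawSemiring
open import Data.Bool.Base using (Bool; true; false; not; if_then_else_)
open import Data.Bool.Properties using (not-¬) renaming (_≟_ to _≟ᵇ_)
open import Data.Fin.Base as Fin using (Fin; zero; suc; toℕ; inject≤)
open import Data.Fin.Properties using (inject≤-injective)
open import Data.Fin.Subset using (Subset; inside; outside; ∣_∣) renaming (_⊆_ to _⊆ₛ_; _∈_ to _∈ₛ_)
open import Data.Fin.Subset.Properties using (s⊆s; out⊆; ∣p∣≤n)
import Data.Integer.Base as ℤ
import Data.Integer.Properties as ℤ
open import Data.List.Base using (List; []; _∷_; length; take; drop; reverse; map; _++_)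
open import Data.List.Membership.Propositional using (_∈_)
open import Data.List.Membership.Propositional.Properties using (∈-map⁺; ∈-++⁺ˡ; ∈-++⁺ʳ)
open import Data.List.Properties
  using (take-all; take-[]; drop-[]; length-take; length-drop; length-reverse; length-map; length-++;
         unfold-reverse; reverse-involutive)
open import Data.List.Relation.Binary.Sublist.Propositional
  using (_⊆_; []; _∷_; _∷ʳ_; ⊆-refl; ⊆-trans; minimum)
open import Data.List.Relation.Binary.Sublist.Propositional.Properties
  using (All-resp-⊆; take-⊆; drop-⊆; reverse⁺)
open import Data.List.Relation.Unary.All as All using (All; []; _∷_)
open import Data.List.Relation.Unary.All.Properties using ()
  renaming (take⁺ to All-take; map⁺ to All-map; ++⁺ to All-++)
open import Data.List.Relation.Unary.AllPairs using (AllPairs; []; _∷_)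
import Data.List.Relation.Unary.AllPairs.Properties as AllPairs
open import Data.List.Relation.Unary.Any using (here; there)
open import Data.List.Relation.Unary.Any.Properties using () renaming (reverse⁻ to Any-reverse⁻)
open import Data.List.Relation.Unary.Linked using (Linked; []; [-]; _∷_)
open import Data.List.Relation.Unary.Linked.Properties using (Linked⇒AllPairs; AllPairs⇒Linked)
open import Data.Maybe.Base as Maybe using (Maybe; just; nothing; maybe′)
open import Data.Nat.Base hiding (_/_; _%_; +-*-rawSemiring)
open import Data.Nat.Coprimality as Coprimality using (1-coprimeTo)
open import Data.Nat.DivMod using (_/_; _%_; m≡m%n+[m/n]*n; m%n<n; m/n*n≤m; /-monoˡ-≤)
open import Data.Nat.ListAction using (sum)
open import Data.Nat.Properties
open import Data.Nat.Tactic.RingSolver using (solve-∀)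
open import Data.Product.Base using (Σ-syntax; ∃-syntax; _×_; _,_; proj₁; proj₂)
open import Data.Rational.Base using (ℚ; mkℚ; 0ℚ; *<*; +-*-rawSemiring)
  renaming (_*_ to _*ℚ_; _<_ to _<ℚ_; _/_ to _/ℚ_)
import Data.Rational.Properties as ℚ
import Data.Rational.Unnormalised.Base as ℚᵘ
import Data.Rational.Unnormalised.Properties as ℚᵘ
open import Data.Sum.Base using (_⊎_; inj₁; inj₂)
open import Data.Unit.Base using (⊤; tt)
open import Data.Vec.Base as Vec using (Vec; []; _∷_; here; there) renaming (_++_ to _++ᵥ_)
open import Data.Vec.Properties using (take++drop≡id)
open import Data.Vec.Relation.Binary.Pointwise.Inductive as Pointwise using (Pointwise; []; _∷_)
open import Function.Base using (_∘_; id; case_of_)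
open import Relation.Binary.Definitions using (Transitive)
open import Relation.Binary.PropositionalEquality
open import Relation.Nullary.Decidable using (yes; no; does; dec-true; dec-false)
open import Relation.Nullary.Negation using (¬_; contradiction)

private variable
  A B C : Set
  k n N : ℕ

-- Lists

AllPairs-resp-⊆ : ∀ {R : A → A → Set} {xs ys : List A} → xs ⊆ ys → AllPairs R ys → AllPairs R xs
AllPairs-resp-⊆ []         []       = []
AllPairs-resp-⊆ (_ ∷ʳ τ)   (_ ∷ ps) = AllPairs-resp-⊆ τ ps
AllPairs-resp-⊆ (refl ∷ τ) (p ∷ ps) = All-resp-⊆ τ p ∷ AllPairs-resp-⊆ τ ps

All-reverse : ∀ {P : A → Set} {xs} → All P xs → All P (reverse xs)
All-reverse ps = All.tabulate (All.lookup ps ∘ Any-reverse⁻)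

AllPairs-reverse : ∀ {R : A → A → Set} {xs : List A} →
  AllPairs R xs → AllPairs (λ x y → R y x) (reverse xs)
AllPairs-reverse {xs = []}     []       = []
AllPairs-reverse {R = R} {xs = x ∷ xs} (p ∷ ps) =
  subst (AllPairs _) (sym (unfold-reverse x xs))
    (AllPairs.++⁺ (AllPairs-reverse ps) ([] ∷ [])
      (All.map (_∷ []) (All-reverse p)))

adjacent : (A → A → B) → List A → List B
adjacent f []           = []
adjacent f (x ∷ [])     = []
adjacent f (x ∷ y ∷ xs) = f x y ∷ adjacent f (y ∷ xs)

module _ (f : A → A → B) where

  adjacent-take : ∀ n xs → adjacent f (take (suc n) xs) ≡ take n (adjacent f xs)
  adjacent-take n       []           = sym (take-[] n)
  adjacent-take zero    (x ∷ [])     = refl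
  adjacent-take (suc n) (x ∷ [])     = refl
  adjacent-take zero    (x ∷ y ∷ xs) = refl
  adjacent-take (suc n) (x ∷ y ∷ xs) = cong (f x y ∷_) (adjacent-take n (y ∷ xs))

  adjacent-drop : ∀ n xs → adjacent f (drop n xs) ≡ drop n (adjacent f xs)
  adjacent-drop zero    xs           = refl
  adjacent-drop (suc n) []           = refl
  adjacent-drop (suc n) (x ∷ [])     = cong (adjacent f) (drop-[] n)
  adjacent-drop (suc n) (x ∷ y ∷ xs) = adjacent-drop n (y ∷ xs)

  length-adjacent : ∀ x xs → length (adjacent f (x ∷ xs)) ≡ length xs
  length-adjacent x []       = refl
  length-adjacent x (y ∷ xs) = cong suc (length-adjacent y xs)

-- Binary words

-- The parity of the length of the initial run of b, or nothing on a run of b.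
changeParity : Bool → List Bool → Maybe Bool
changeParity b []       = nothing
changeParity b (x ∷ xs) with x ≟ᵇ b
... | yes _ = Maybe.map not (changeParity b xs)
... | no  _ = just false

wordColour : List Bool → Maybe (Bool × Bool)
wordColour []       = nothing
wordColour (b ∷ bs) = Maybe.map (b ,_) (changeParity b bs)

changeParity-∷ : ∀ b xs → changeParity b (b ∷ xs) ≡ Maybe.map not (changeParity b xs)
changeParity-∷ b xs with b ≟ᵇ b
... | yes _  = refl
... | no b≢b = contradiction refl b≢b

changeParity-≢ : ∀ {b x xs} → x ≢ b → changeParity b (x ∷ xs) ≡ just false
changeParity-≢ {b} {x} x≢b with x ≟ᵇ b
... | yes x≡b = contradiction x≡b x≢b
... | no _    = refl

-- Once a window shows the end of the initial run, lengthening it does not move that end.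
changeParity-take : ∀ b n xs {p} → changeParity b (take n xs) ≡ just p →
  changeParity b (take (suc n) xs) ≡ just p
changeParity-take b (suc n) (x ∷ xs) eq with x ≟ᵇ b
... | no  _ = eq
... | yes _ with changeParity b (take n xs) in eq′
...   | just p = trans (cong (Maybe.map not) (changeParity-take b n xs eq′)) eq

changeParity-nothing : ∀ b xs → changeParity b xs ≡ nothing → All (_≡ b) xs
changeParity-nothing b []       eq = []
changeParity-nothing b (x ∷ xs) eq with x ≟ᵇ b
... | yes x≡b with changeParity b xs in eq′
...   | nothing = x≡b ∷ changeParity-nothing b xs eq′

changeParity-constant : ∀ {b xs} → All (_≡ b) xs → changeParity b xs ≡ nothing
changeParity-constant         []          = refl
changeParity-constant {b} {_ ∷ xs} (refl ∷ ps) =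
  trans (changeParity-∷ b xs) (cong (Maybe.map not) (changeParity-constant ps))

-- Only windows containing a turn are constrained: a turn-free one inherits its colour from one
-- uniformity lower.
Homogeneous : ℕ → Bool × Bool → List Bool → Set
Homogeneous w c B = ∀ s {c′} → w ≤ length (drop s B) →
  wordColour (take w (drop s B)) ≡ just c′ → c′ ≡ c

-- A turn in a window starting with `b` would make `b` the first component of `c`. So that window is
-- constant, the next one starts with `b` again, and the argument slides to the end of the word.
constant-tail : ∀ v b {c} B → Homogeneous (2 + v) c (b ∷ B) → b ≢ proj₁ c →
  suc v ≤ length B → All (_≡ b) (b ∷ B)
constant-tail v b B h b≢c v<∣B∣ with changeParity b (take (suc v) B) in eq
... | just p = contradiction (cong proj₁ (h 0 (s≤s v<∣B∣) (cong (Maybe.map (b ,_)) eq))) b≢c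
... | nothing with m≤n⇒m<n∨m≡n v<∣B∣
...   | inj₂ eq′ = refl ∷ subst (All (_≡ b)) (take-all (suc v) B (≤-reflexive (sym eq′)))
                     (changeParity-nothing b _ eq)
constant-tail v b (x ∷ B) h b≢c v<∣B∣ | nothing | inj₁ (s≤s lt)
  with refl ∷ _ ← changeParity-nothing b (x ∷ take v B) eq =
  refl ∷ constant-tail v b B (h ∘ suc) b≢c lt

-- Both the first window and its shift by one see the end of the initial run, at positions of
-- different parity, unless the run is longer than the window.
constant-init : ∀ v b {c} m B → length B ≡ suc m → suc v ≤ m →
  Homogeneous (3 + v) c (b ∷ b ∷ B) → All (_≡ b) (take (2 + m) (b ∷ b ∷ B))
constant-init v b {c} m B ∣B∣≡1+m v<m h with changeParity b (take (suc v) B) in eq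
... | just p = contradiction (cong proj₂ (trans window₁ (sym window₀))) (not-¬ refl)
  where
  window₀ : (b , not p) ≡ c
  window₀ = h 0 (s≤s (s≤s (≤-trans v<m (≤-trans (n≤1+n m) (≤-reflexive (sym ∣B∣≡1+m))))))
    (cong (Maybe.map (b ,_)) (trans (changeParity-∷ b _) (cong (Maybe.map not) eq)))
  window₁ : (b , p) ≡ c
  window₁ = h 1 (s≤s (≤-trans (s≤s v<m) (≤-reflexive (sym ∣B∣≡1+m))))
    (cong (Maybe.map (b ,_)) (changeParity-take b (suc v) B eq))
... | nothing with m≤n⇒m<n∨m≡n v<m
-- The last letter lies only in the last window, which has no further shift to be compared with.
...   | inj₂ refl = refl ∷ refl ∷ changeParity-nothing b _ eq
constant-init v b (suc m) (x ∷ B) ∣B∣≡1+m v<m h | nothing | inj₁ (s≤s lt)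
  with refl ∷ _ ← changeParity-nothing b (x ∷ take v B) eq =
  refl ∷ constant-init v b m B (suc-injective ∣B∣≡1+m) lt (h ∘ suc)

-- If the first two letters differ, the first window turns at once, so `c` has direction `b`. The
-- rest starts in the other direction and can never turn again.
constant-init⊎tail : ∀ v {c} m B → length B ≡ suc m → 3 + v ≤ m → Homogeneous (3 + v) c B →
  ∃[ b ] (All (_≡ b) (take m B) ⊎ All (_≡ b) (drop 1 B))
constant-init⊎tail v (suc (suc m)) (b ∷ b′ ∷ B) ∣B∣≡ (s≤s (s≤s v<m)) h with b′ ≟ᵇ b
... | yes refl = b , inj₁ (constant-init v b m B (suc-injective (suc-injective ∣B∣≡)) v<m h)
... | no b′≢b  = b′ , inj₂ (constant-tail (suc v) b′ B (h ∘ suc)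
      (λ b′≡c → b′≢b (trans b′≡c (sym b≡c))) v<∣B∣)
  where
  v<∣B∣ : 2 + v ≤ length B
  v<∣B∣ = ≤-trans (s≤s v<m) (≤-reflexive (sym (suc-injective (suc-injective ∣B∣≡))))
  b≡c : b ≡ _
  b≡c = cong proj₁ (h 0 (s≤s (s≤s (≤-trans (n≤1+n _) v<∣B∣)))
    (cong (Maybe.map (b ,_)) (changeParity-≢ b′≢b)))

-- Every turn leaves the direction `proj₁ c`, while consecutive turns leave opposite directions;
-- hence there is at most one. The first run is `b ∷ take i B`.
two-runs : ∀ {c} b B → Homogeneous 2 c (b ∷ B) →
  ∃[ i ] (i ≤ length B × All (_≡ b) (take i B) × ∃[ b′ ] All (_≡ b′) (drop i B))
two-runs b []      h = 0 , z≤n , [] , b , []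
two-runs b (x ∷ B) h with x ≟ᵇ b
... | yes refl with i , i≤ , p , q ← two-runs b B (h ∘ suc) = suc i , s≤s i≤ , refl ∷ p , q
two-runs b (x ∷ [])    h | no x≢b = 0 , z≤n , [] , x , refl ∷ []
two-runs b (x ∷ y ∷ B) h | no x≢b = 0 , z≤n , [] , x ,
  constant-tail 0 x (y ∷ B) (h ∘ suc) (λ x≡c → x≢b (trans x≡c (sym b≡c))) (s≤s z≤n)
  where
  b≡c : b ≡ _
  b≡c = cong proj₁ (h 0 (s≤s (s≤s z≤n)) (cong (Maybe.map (b ,_)) (changeParity-≢ x≢b)))

-- The most significant differing digit

δ : ℕ → ℕ → ℕ → ℕ
δ zero    x y = 0
δ (suc N) x y with x <? 2 ^ N | y <? 2 ^ N
... | yes _ | yes _ = δ N x y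
... | no _  | no _  = δ N (x ∸ 2 ^ N) (y ∸ 2 ^ N)
... | _     | _     = N

∸-bound : ∀ N {x} → ¬ x < 2 ^ N → x < 2 ^ suc N → x ∸ 2 ^ N < 2 ^ N
∸-bound N {x} x≮ x< = subst (x ∸ 2 ^ N <_)
  (trans (m+n∸m≡n (2 ^ N) _) (+-identityʳ _)) (∸-monoˡ-< x< (≮⇒≥ x≮))

δ-bound : ∀ N {x y} → x < y → y < 2 ^ N → δ N x y < N
δ-bound zero    {zero} {suc _} x<y (s≤s ())
δ-bound zero    {suc _} {suc _} x<y (s≤s ())
δ-bound (suc N) {x} {y} x<y y< with x <? 2 ^ N | y <? 2 ^ N
... | yes _ | yes y<′ = m≤n⇒m≤1+n (δ-bound N x<y y<′)
... | yes _ | no _  = ≤-refl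
... | no x≮ | yes y<′ = contradiction (<-trans x<y y<′) x≮
... | no x≮ | no y≮ = m≤n⇒m≤1+n (δ-bound N (∸-monoˡ-< x<y (≮⇒≥ x≮)) (∸-bound N y≮ y<))

-- Strip the leading digits common to all three. At the next digit `x < y < z` allows only 0, 0, 1
-- and 0, 1, 1; the neighbours separated there have the larger `δ`, and `x`, `z` are separated there
-- too.
δ-ultrametric : ∀ N {x y z} → x < y → y < z → z < 2 ^ N →
  (δ N x y < δ N y z × δ N x z ≡ δ N y z) ⊎ (δ N y z < δ N x y × δ N x z ≡ δ N x y)
δ-ultrametric zero    {z = suc _} x<y y<z (s≤s ())
δ-ultrametric (suc N) {x} {y} {z} x<y y<z z< with x <? 2 ^ N | y <? 2 ^ N | z <? 2 ^ N
... | yes _ | yes _   | yes z<′ = δ-ultrametric N x<y y<z z<′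
... | yes _ | yes y<′ | no _    = inj₁ (δ-bound N x<y y<′ , refl)
... | yes _ | no y≮   | no z≮   = inj₂ (δ-bound N (∸-monoˡ-< y<z (≮⇒≥ y≮)) (∸-bound N z≮ z<) , refl)
... | no x≮ | no y≮   | no z≮   =
      δ-ultrametric N (∸-monoˡ-< x<y (≮⇒≥ x≮)) (∸-monoˡ-< y<z (≮⇒≥ y≮)) (∸-bound N z≮ z<)
... | no x≮ | yes y<′ | _       = contradiction (<-trans x<y y<′) x≮
... | _     | no y≮   | yes z<′ = contradiction (<-trans y<z z<′) y≮

Δ : ℕ → List ℕ → List ℕ
Δ N = adjacent (δ N)

-- On the `δ`-sequence of an increasing list neighbouring terms are distinct by `δ-ultrametric`, so
-- `false` means a strict descent.
ascents : List ℕ → List Bool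
ascents = adjacent λ d e → does (d <? e)

Directed : Bool → ℕ → ℕ → Set
Directed true  = _<_
Directed false = _>_

Directed-trans : ∀ b → Transitive (Directed b)
Directed-trans true  p q = <-trans p q
Directed-trans false p q = <-trans q p

-- Colourings are only controlled on increasing lists, so a falling `δ`-sequence is reversed before
-- it is coloured.
orient : Bool → List A → List A
orient true  = id
orient false = reverse

directed : ∀ b {d e} → d < e ⊎ e < d → does (d <? e) ≡ b → Directed b d e
directed true  {d} {e} (inj₁ d<e) eq = d<e
directed false {d} {e} (inj₁ d<e) eq = case trans (sym eq) (dec-true (d <? e) d<e) of λ ()
directed true  {d} {e} (inj₂ e<d) eq = case trans (sym eq) (dec-false (d <? e) (<-asym e<d)) of λ ()
directed false {d} {e} (inj₂ e<d) eq = e<d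

undirected : ∀ b {d e} → Directed b d e → does (d <? e) ≡ b
undirected true  {d} {e} d<e = dec-true (d <? e) d<e
undirected false {d} {e} e<d = dec-false (d <? e) (<-asym e<d)

ascents-constant : ∀ b {ds} → AllPairs (Directed b) ds → All (_≡ b) (ascents ds)
ascents-constant b = from-linked ∘ AllPairs⇒Linked
  where
  from-linked : ∀ {ds} → Linked (Directed b) ds → All (_≡ b) (ascents ds)
  from-linked []       = []
  from-linked [-]      = []
  from-linked (p ∷ ps) = undirected b p ∷ from-linked ps

Increasing : List ℕ → Set
Increasing = AllPairs _<_

module _ (N : ℕ) where

  Δ-bounded : ∀ {xs} → Increasing xs → All (_< 2 ^ N) xs → All (_< N) (Δ N xs)
  Δ-bounded {[]}         _                    _             = []
  Δ-bounded {x ∷ []}     _                    _             = []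
  Δ-bounded {x ∷ y ∷ xs} ((x<y ∷ _) ∷ ps) (_ ∷ y< ∷ qs) =
    δ-bound N x<y y< ∷ Δ-bounded ps (y< ∷ qs)

  Δ-directed : ∀ b {xs} → Increasing xs → All (_< 2 ^ N) xs →
    All (_≡ b) (ascents (Δ N xs)) → AllPairs (Directed b) (Δ N xs)
  Δ-directed b ps qs = Linked⇒AllPairs (Directed-trans b) ∘ linked ps qs
    where
    linked : ∀ {xs} → Increasing xs → All (_< 2 ^ N) xs →
      All (_≡ b) (ascents (Δ N xs)) → Linked (Directed b) (Δ N xs)
    linked {[]}             _  _ _ = []
    linked {x ∷ []}         _  _ _ = []
    linked {x ∷ y ∷ []}     _  _ _ = [-]
    linked {x ∷ y ∷ z ∷ xs} ((x<y ∷ _) ∷ ps@((y<z ∷ _) ∷ _)) (_ ∷ qs@(_ ∷ z< ∷ _)) (eq ∷ eqs) =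
      directed b (case δ-ultrametric N x<y y<z z< of λ where
        (inj₁ (lt , _)) → inj₁ lt
        (inj₂ (gt , _)) → inj₂ gt) eq ∷ linked ps qs eqs

  -- To omit the term `δ N x y`, omit `y`. If `t` is the next point kept, `δ N y t` is a later,
  -- hence larger, term, so `δ N x t ≡ δ N y t` and `x` can replace `y` as head of the lifted list.
  lift-increasing : ∀ {S} x xs → Increasing (x ∷ xs) → All (_< 2 ^ N) (x ∷ xs) →
    Increasing (Δ N (x ∷ xs)) → S ⊆ Δ N (x ∷ xs) →
    ∃[ T ] (T ⊆ xs × Δ N (x ∷ T) ≡ S)
  lift-increasing x []       _        _        _        []         = [] , [] , refl
  lift-increasing x (y ∷ ys) (_ ∷ ps) (_ ∷ qs) (_ ∷ rs) (refl ∷ τ)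
    with T , T⊆ys , refl ← lift-increasing y ys ps qs rs τ = y ∷ T , refl ∷ T⊆ys , refl
  lift-increasing x (y ∷ ys) ((x<y ∷ _) ∷ p ∷ ps) (_ ∷ q ∷ qs) (r ∷ rs) (_ ∷ʳ τ)
    with lift-increasing y ys (p ∷ ps) (q ∷ qs) rs τ
  ... | []    , T⊆ys , refl = [] , minimum _ , refl
  ... | t ∷ T , T⊆ys , refl = t ∷ T , y ∷ʳ T⊆ys , cong (_∷ Δ N (t ∷ T)) δxt≡δyt
    where
    δxt≡δyt : δ N x t ≡ δ N y t
    δxt≡δyt with δ-ultrametric N x<y (All.head (All-resp-⊆ T⊆ys p)) (All.head (All-resp-⊆ T⊆ys qs))
    ... | inj₁ (_ , eq)  = eq
    ... | inj₂ (gt , _) = contradiction gt (<-asym (All.head (All-resp-⊆ τ r)))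

  -- By the ultrametric law `δ N y t` is the maximum of the terms between `y` and `t`.
  δ-head-bound : ∀ {d} y ys → Increasing (y ∷ ys) → All (_< 2 ^ N) (y ∷ ys) →
    All (_< d) (Δ N (y ∷ ys)) → All (λ t → δ N y t < d) ys
  δ-head-bound y []       _                      _             _        = []
  δ-head-bound {d} y (z ∷ zs) ((y<z ∷ _) ∷ p ∷ ps) (_ ∷ q ∷ qs) (r ∷ rs) =
    r ∷ All.zipWith larger (All.zip (p , qs) , δ-head-bound z zs (p ∷ ps) (q ∷ qs) rs)
    where
    larger : ∀ {t} → (z < t × t < 2 ^ N) × δ N z t < d → δ N y t < d
    larger ((z<t , t<) , δzt<d) with δ-ultrametric N y<z z<t t<
    ... | inj₁ (_ , eq) = subst (_< d) (sym eq) δzt<d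
    ... | inj₂ (_ , eq) = subst (_< d) (sym eq) r

  -- Here a term `δ N x y` is omitted by omitting `x`. To keep it, put `x` before the lifted list,
  -- even if that starts at a later `t`: all later terms are smaller, so `δ N x t ≡ δ N x y`.
  lift-decreasing : ∀ {S} x xs → Increasing (x ∷ xs) → All (_< 2 ^ N) (x ∷ xs) →
    AllPairs _>_ (Δ N (x ∷ xs)) → S ⊆ Δ N (x ∷ xs) →
    ∃[ t ] ∃[ T ] (t ∷ T ⊆ x ∷ xs × Δ N (t ∷ T) ≡ S)
  lift-decreasing x []       _        _        _        []       = x , [] , ⊆-refl , refl
  lift-decreasing x (y ∷ ys) (_ ∷ ps) (_ ∷ qs) (_ ∷ rs) (_ ∷ʳ τ)
    with t , T , t∷T⊆ , refl ← lift-decreasing y ys ps qs rs τ = t , T , x ∷ʳ t∷T⊆ , refl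
  lift-decreasing x (y ∷ ys) ((x<y ∷ _) ∷ p ∷ ps) (_ ∷ qs) (r ∷ rs) (refl ∷ τ)
    with lift-decreasing y ys (p ∷ ps) qs rs τ
  ... | _ , T , refl ∷ T⊆ , refl = x , y ∷ T , refl ∷ refl ∷ T⊆ , refl
  ... | t , T , _ ∷ʳ t∷T⊆ , refl = x , t ∷ T , refl ∷ y ∷ʳ t∷T⊆ , cong (_∷ Δ N (t ∷ T)) δxt≡δxy
    where
    δxt≡δxy : δ N x t ≡ δ N x y
    δxt≡δxy with δ-ultrametric N x<y (All.head (All-resp-⊆ t∷T⊆ p))
                   (All.head (All-resp-⊆ t∷T⊆ (All.tail qs)))
    ... | inj₁ (lt , _) = contradiction lt
          (<-asym (All.head (All-resp-⊆ t∷T⊆ (δ-head-bound y ys (p ∷ ps) qs r))))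
    ... | inj₂ (_ , eq) = eq

  lift : ∀ b {S} x xs → Increasing (x ∷ xs) → All (_< 2 ^ N) (x ∷ xs) →
    AllPairs (Directed b) (Δ N (x ∷ xs)) → S ⊆ Δ N (x ∷ xs) →
    ∃[ t ] ∃[ T ] (t ∷ T ⊆ x ∷ xs × Δ N (t ∷ T) ≡ S)
  lift false = lift-decreasing
  lift true x xs ps qs rs τ with T , T⊆xs , eq ← lift-increasing x xs ps qs rs τ =
    x , T , refl ∷ T⊆xs , eq

-- Stepping up

Monochrome : (k : ℕ) → (List ℕ → C) → C → List ℕ → Set
Monochrome k φ c A = ∀ S → S ⊆ A → length S ≡ k → φ S ≡ c

Avoids : (k n N : ℕ) → (List ℕ → C) → Set
Avoids k n N φ =
  ∀ A → Increasing A → All (_< N) A → ∀ c → Monochrome k φ c A → length A < n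

orient-Increasing : ∀ b {ds} → AllPairs (Directed b) ds → Increasing (orient b ds)
orient-Increasing true  = id
orient-Increasing false = AllPairs-reverse

length-orient : ∀ b (xs : List A) → length (orient b xs) ≡ length xs
length-orient true  xs = refl
length-orient false xs = length-reverse xs

orient-involutive : ∀ b (xs : List A) → orient b (orient b xs) ≡ xs
orient-involutive true  xs = refl
orient-involutive false xs = reverse-involutive xs

orient-⊆ : ∀ b {xs ys : List A} → xs ⊆ ys → orient b xs ⊆ orient b ys
orient-⊆ true  = id
orient-⊆ false = reverse⁺

All-orient : ∀ b {P : A → Set} {xs} → All P xs → All P (orient b xs)
All-orient true  = id
All-orient false = All-reverse

-- The oriented `δ`-sequence is an increasing list below `N`. By `lift` each of its `k`-element
-- sublists comes from `k + 1` points of `A` and so has colour `c`; hence `φ` bounds its length.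
directed-piece : ∀ {φ : List ℕ → C} → Avoids k n N φ → 0 < n →
  ∀ A → Increasing A → All (_< 2 ^ N) A → ∀ b → All (_≡ b) (ascents (Δ N A)) →
  ∀ c → (∀ T → T ⊆ A → length T ≡ suc k → All (_≡ b) (ascents (Δ N T)) →
    φ (orient b (Δ N T)) ≡ c) →
  length (Δ N A) < n
directed-piece _ 0<n [] _ _ _ _ _ _ = 0<n
directed-piece {k = k} {n} {N} {φ} avoids _ A@(x ∷ xs) incr bound b const c mono =
  subst (_< n) (length-orient b (Δ N A))
    (avoids (orient b (Δ N A)) (orient-Increasing b dir) (All-orient b (Δ-bounded N incr bound)) c colour)
  where
  dir : AllPairs (Directed b) (Δ N A)
  dir = Δ-directed N b incr bound const
  colour : Monochrome k φ c (orient b (Δ N A))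
  colour S S⊆ ∣S∣≡k
    with S′⊆ ← subst (orient b S ⊆_) (orient-involutive b (Δ N A)) (orient-⊆ b S⊆)
    with t , T , t∷T⊆A , eq ← lift N b x xs incr bound dir S′⊆ =
    trans (cong φ (sym (trans (cong (orient b) eq) (orient-involutive b S))))
      (mono (t ∷ T) t∷T⊆A
        (cong suc (trans (sym (length-adjacent (δ N) t T))
          (trans (cong length eq) (trans (length-orient b S) ∣S∣≡k))))
        (subst (All (_≡ b) ∘ ascents) (sym eq) (ascents-constant b (AllPairs-resp-⊆ S′⊆ dir))))

colourAlong : (List ℕ → Bool × Bool) → List ℕ → List Bool → Bool × Bool
colourAlong φ ds []       = φ ds
colourAlong φ ds (b ∷ bs) = maybe′ (b ,_) (φ (orient b ds)) (changeParity b bs)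

stepUp : ℕ → (List ℕ → Bool × Bool) → List ℕ → Bool × Bool
stepUp N φ A = colourAlong φ (Δ N A) (ascents (Δ N A))

colourAlong-word : ∀ φ ds bs {c} → wordColour bs ≡ just c → colourAlong φ ds bs ≡ c
colourAlong-word φ ds (b ∷ bs) eq with changeParity b bs
colourAlong-word φ ds (b ∷ bs) refl | just _ = refl

colourAlong-constant : ∀ φ ds {b bs} → 0 < length bs → All (_≡ b) bs →
  colourAlong φ ds bs ≡ φ (orient b ds)
colourAlong-constant φ ds {b} _ (refl ∷ ps)
  rewrite changeParity-constant ps = refl

length-take-≤ : ∀ m (xs : List A) → m ≤ length xs → length (take m xs) ≡ m
length-take-≤ m xs m≤ = trans (length-take m xs) (m≤n⇒m⊓n≡m m≤)

module _ (N : ℕ) where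

  length-ascents : ∀ x y xs → length (ascents (Δ N (x ∷ y ∷ xs))) ≡ length xs
  length-ascents x y xs = trans (length-adjacent _ (δ N x y) (Δ N (y ∷ xs))) (length-adjacent (δ N) y xs)

  ascents-take : ∀ n A → ascents (Δ N (take (2 + n) A)) ≡ take n (ascents (Δ N A))
  ascents-take n A = trans (cong ascents (adjacent-take (δ N) (suc n) A)) (adjacent-take _ n (Δ N A))

  ascents-drop : ∀ n A → ascents (Δ N (drop n A)) ≡ drop n (ascents (Δ N A))
  ascents-drop n A = trans (cong ascents (adjacent-drop (δ N) n A)) (adjacent-drop _ n (Δ N A))

  length-ascents⁻ : ∀ {w} A → suc w ≤ length (ascents (Δ N A)) → 3 + w ≤ length A
  length-ascents⁻ {w} (x ∷ y ∷ xs) w< = s≤s (s≤s (subst (suc w ≤_) (length-ascents x y xs) w<))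

  module _ {φ : List ℕ → Bool × Bool} {c : Bool × Bool} where

    -- A factor of `1 + w` letters belongs to `3 + w` consecutive points: passing to differences and
    -- then to directions costs one term each.
    stepUp-homogeneous : ∀ {w} A → Monochrome (3 + w) (stepUp N φ) c A →
      Homogeneous (suc w) c (ascents (Δ N A))
    stepUp-homogeneous {w} A mono s w< eq = trans
      (sym (colourAlong-word φ (Δ N window) (ascents (Δ N window)) (trans (cong wordColour ascents≡) eq)))
      (mono window (⊆-trans (take-⊆ (3 + w) (drop s A)) (drop-⊆ s A))
        (length-take-≤ (3 + w) (drop s A)
          (length-ascents⁻ (drop s A) (subst (λ bs → suc w ≤ length bs) (sym (ascents-drop s A)) w<))))
      where
      window = take (3 + w) (drop s A)
      ascents≡ : ascents (Δ N window) ≡ take (suc w) (drop s (ascents (Δ N A)))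
      ascents≡ = trans (ascents-take (suc w) (drop s A)) (cong (take (suc w)) (ascents-drop s A))

    stepUp-piece : ∀ {w} → Avoids (2 + w) n N φ → 0 < n → ∀ {A A′} → Increasing A → All (_< 2 ^ N) A →
      Monochrome (3 + w) (stepUp N φ) c A → A′ ⊆ A → ∀ {b} → All (_≡ b) (ascents (Δ N A′)) →
      length (Δ N A′) < n
    stepUp-piece avoids 0<n {A′ = A′} incr bound mono A′⊆A {b} const =
      directed-piece avoids 0<n A′ (AllPairs-resp-⊆ A′⊆A incr) (All-resp-⊆ A′⊆A bound) b const c
        λ T T⊆A′ ∣T∣≡ bs → trans (sym (colourAlong-constant φ (Δ N T) (nonempty T ∣T∣≡) bs))
          (mono T (⊆-trans T⊆A′ A′⊆A) ∣T∣≡)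
      where
      nonempty : ∀ {w} T → length T ≡ 3 + w → 0 < length (ascents (Δ N T))
      nonempty (x ∷ y ∷ z ∷ zs) _ = s≤s z≤n

-- Of the added 2, one pays for the end point whose removal makes the `δ`-sequence monotone, the
-- other for a list having one entry more than its `δ`-sequence.
stepUp-avoids : ∀ {v φ} → Avoids (4 + v) n N φ → 4 + v ≤ n → Avoids (5 + v) (2 + n) (2 ^ N) (stepUp N φ)
stepUp-avoids {n} {N} {v} {φ} avoids k≤n A incr bound c mono with suc (length A) ≤? 2 + n
... | yes small = small
stepUp-avoids avoids k≤n []      _ _ _ _ | no large = contradiction (s≤s z≤n) large
stepUp-avoids avoids k≤n (_ ∷ []) _ _ _ _ | no large = contradiction (s≤s (s≤s z≤n)) large
stepUp-avoids {suc n} {N} {v} {φ} avoids (s≤s k≤n) A@(x ∷ y ∷ xs) incr bound c mono | no large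
  with length xs in ∣xs∣≡
... | zero = contradiction (s≤s (s≤s (s≤s z≤n))) large
... | suc m = contradiction 1+m<n (≤⇒≯ (s≤s n≤m))
  where
  word = ascents (Δ N A)
  ∣word∣≡ : length word ≡ suc m
  ∣word∣≡ = trans (length-ascents N x y xs) ∣xs∣≡
  n≤m : n ≤ m
  n≤m = ≤-pred (≤-pred (≤-pred (≤-pred (≰⇒> large))))
  piece : ∀ {A′} → A′ ⊆ A → ∀ {b} → All (_≡ b) (ascents (Δ N A′)) → length (Δ N A′) < suc n
  piece = stepUp-piece N avoids (s≤s z≤n) incr bound mono
  1+m<n : 2 + m ≤ suc n
  1+m<n with constant-init⊎tail v m word ∣word∣≡ (≤-trans k≤n n≤m) (stepUp-homogeneous N {φ} A mono)
  ... | b , inj₁ init = subst (_< suc n)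
        (trans (cong length (adjacent-take (δ N) (suc m) A))
          (length-take-≤ (suc m) (Δ N A) (≤-trans (n≤1+n (suc m)) (≤-reflexive (sym
            (trans (length-adjacent (δ N) x (y ∷ xs)) (cong suc ∣xs∣≡)))))))
        (piece (take-⊆ (2 + m) A) (subst (All (_≡ b)) (sym (ascents-take N m A)) init))
  ... | b , inj₂ tail = subst (_< suc n)
        (trans (length-adjacent (δ N) y xs) ∣xs∣≡)
        (piece (x ∷ʳ ⊆-refl) (subst (All (_≡ b)) (sym (ascents-drop N 1 A)) tail))

-- The two runs give two pieces with monotone `δ`-sequences, each shorter than `n`. These overlap in
-- one term, so their lengths add up to `length A`.
stepUp-avoids-3 : ∀ {φ} → Avoids 3 n N φ → 2 ≤ n → Avoids 4 (n + n) (2 ^ N) (stepUp N φ)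
stepUp-avoids-3 _ 2≤n []           _ _ _ _ = ≤-trans (≤-trans (n≤1+n _) 2≤n) (m≤m+n _ _)
stepUp-avoids-3 _ 2≤n (_ ∷ [])     _ _ _ _ = ≤-trans 2≤n (m≤m+n _ _)
stepUp-avoids-3 _ 2≤n (_ ∷ _ ∷ []) _ _ _ _ = ≤-trans (n≤1+n 3) (+-mono-≤ 2≤n 2≤n)
stepUp-avoids-3 {n} {N} {φ} avoids 2≤n A@(x ∷ y ∷ z ∷ xs) incr bound c mono
  with two-runs _ _ (stepUp-homogeneous N {φ} A mono)
... | i , i≤ , run₁ , b , run₂ = subst (_< n + n) lengths (+-mono-< front back)
  where
  B′ = ascents (Δ N (y ∷ z ∷ xs))
  ∣B′∣≡ : length B′ ≡ length xs
  ∣B′∣≡ = length-ascents N y z xs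
  i≤∣xs∣ : i ≤ length xs
  i≤∣xs∣ = ≤-trans i≤ (≤-reflexive ∣B′∣≡)
  ∣ΔA∣≡ : length (Δ N A) ≡ 2 + length xs
  ∣ΔA∣≡ = length-adjacent (δ N) x (y ∷ z ∷ xs)
  piece : ∀ {A′} → A′ ⊆ A → ∀ {b} → All (_≡ b) (ascents (Δ N A′)) → length (Δ N A′) < n
  piece = stepUp-piece N avoids (≤-trans (s≤s z≤n) 2≤n) incr bound mono
  front : 2 + i < n
  front = subst (_< n)
    (trans (cong length (adjacent-take (δ N) (2 + i) A))
      (length-take-≤ (2 + i) (Δ N A) (≤-trans (s≤s (s≤s i≤∣xs∣)) (≤-reflexive (sym ∣ΔA∣≡)))))
    (piece (take-⊆ (3 + i) A) (subst (All (_≡ _)) (sym (ascents-take N (suc i) A)) (refl ∷ run₁)))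
  back : suc (length xs) ∸ i < n
  back = subst (_< n)
    (trans (cong length (adjacent-drop (δ N) (suc i) A))
      (trans (length-drop (suc i) (Δ N A)) (cong (_∸ suc i) ∣ΔA∣≡)))
    (piece (drop-⊆ (suc i) A) (subst (All (_≡ b)) (sym (ascents-drop N (suc i) A)) run₂))
  lengths : 2 + i + (suc (length xs) ∸ i) ≡ 3 + length xs
  lengths = cong (2 +_) (m+[n∸m]≡n (m≤n⇒m≤1+n i≤∣xs∣))

pairColourAlong : (List ℕ → Bool) → List ℕ → List Bool → Bool × Bool
pairColourAlong φ ds []      = true , φ ds
pairColourAlong φ ds (b ∷ _) = b , φ (orient b ds)

stepUpPairs : ℕ → (List ℕ → Bool) → List ℕ → Bool × Bool
stepUpPairs N φ A = pairColourAlong φ (Δ N A) (ascents (Δ N A))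

-- Every triple records its direction, so a monochromatic list is a single directed piece; only the
-- passage from points to differences costs 1.
stepUpPairs-avoids : ∀ {φ} → Avoids 2 n N φ → 0 < n → Avoids 3 (suc n) (2 ^ N) (stepUpPairs N φ)
stepUpPairs-avoids             _      0<n []       _    _     _ _    = s≤s z≤n
stepUpPairs-avoids {n} {N} {φ} avoids 0<n A@(x ∷ xs) incr bound c mono = s≤s (subst (_< n)
  (length-adjacent (δ N) x xs)
  (directed-piece avoids 0<n A incr bound (proj₁ c) (constant A mono) (proj₂ c) colour))
  where
  constant : ∀ A → Monochrome 3 (stepUpPairs N φ) c A → All (_≡ proj₁ c) (ascents (Δ N A))
  constant []               _    = []
  constant (x ∷ [])         _    = []
  constant (x ∷ y ∷ [])     _    = []
  constant (x ∷ y ∷ z ∷ xs) mono =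
    cong proj₁ (mono (x ∷ y ∷ z ∷ []) (refl ∷ refl ∷ refl ∷ minimum xs) refl)
    ∷ constant (y ∷ z ∷ xs) λ S S⊆ → mono S (x ∷ʳ S⊆)
  colour : ∀ T → T ⊆ A → length T ≡ 3 → All (_≡ proj₁ c) (ascents (Δ N T)) →
    φ (orient (proj₁ c) (Δ N T)) ≡ proj₂ c
  colour T@(_ ∷ _ ∷ _ ∷ []) T⊆A ∣T∣≡3 (eq ∷ _) =
    trans (cong (λ b → φ (orient b (Δ N T))) (sym eq)) (cong proj₂ (mono T T⊆A ∣T∣≡3))

-- Finite subsets as increasing lists

elements : ∀ {N} → ℕ → Subset N → List ℕ
elements j []            = []
elements j (inside ∷ p)  = j ∷ elements (suc j) p
elements j (outside ∷ p) = elements (suc j) p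

elements-≥ : ∀ j (p : Subset N) → All (j ≤_) (elements j p)
elements-≥ j []            = []
elements-≥ j (inside ∷ p)  = ≤-refl ∷ All.map <⇒≤ (elements-≥ (suc j) p)
elements-≥ j (outside ∷ p) = All.map <⇒≤ (elements-≥ (suc j) p)

elements-< : ∀ j (p : Subset N) → All (_< j + N) (elements j p)
elements-< j []                      = []
elements-< {suc N} j (inside ∷ p)  = m<m+n j (s≤s z≤n) ∷
  subst (λ m → All (_< m) (elements (suc j) p)) (sym (+-suc j N)) (elements-< (suc j) p)
elements-< {suc N} j (outside ∷ p) =
  subst (λ m → All (_< m) (elements (suc j) p)) (sym (+-suc j N)) (elements-< (suc j) p)

elements-increasing : ∀ j (p : Subset N) → Increasing (elements j p)
elements-increasing j []            = []
elements-increasing j (inside ∷ p)  = elements-≥ (suc j) p ∷ elements-increasing (suc j) p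
elements-increasing j (outside ∷ p) = elements-increasing (suc j) p

length-elements : ∀ j (p : Subset N) → length (elements j p) ≡ ∣ p ∣
length-elements j []            = refl
length-elements j (inside ∷ p)  = cong suc (length-elements (suc j) p)
length-elements j (outside ∷ p) = length-elements (suc j) p

sublist-elements : ∀ j (p : Subset N) {S} → S ⊆ elements j p →
  ∃[ q ] (q ⊆ₛ p × elements j q ≡ S)
sublist-elements j []            []       = [] , id , refl
sublist-elements j (outside ∷ p) τ
  with q , q⊆p , eq ← sublist-elements (suc j) p τ = outside ∷ q , s⊆s q⊆p , eq
sublist-elements j (inside ∷ p) (_ ∷ʳ τ)
  with q , q⊆p , eq ← sublist-elements (suc j) p τ = outside ∷ q , out⊆ q⊆p , eq
sublist-elements j (inside ∷ p) (refl ∷ τ)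
  with q , q⊆p , eq ← sublist-elements (suc j) p τ = inside ∷ q , s⊆s q⊆p , cong (j ∷_) eq

elements-surjective : ∀ N j {A} → Increasing A → All (j ≤_) A → All (_< j + N) A →
  Σ[ p ∈ Subset N ] elements j p ≡ A
elements-surjective zero    j {[]} _ _ _ = [] , refl
elements-surjective zero    j {x ∷ A} _ (j≤x ∷ _) (x< ∷ _) =
  contradiction (subst (x <_) (+-identityʳ j) x<) (≤⇒≯ j≤x)
elements-surjective (suc N) j {[]} _ _ _
  with p , eq ← elements-surjective N (suc j) [] [] [] = outside ∷ p , eq
elements-surjective (suc N) j {x ∷ A} (x<A ∷ incr) (j≤x ∷ _) bound with m≤n⇒m<n∨m≡n j≤x
... | inj₁ j<x
  with p , eq ← elements-surjective N (suc j) (x<A ∷ incr) (j<x ∷ All.map (<-trans j<x) x<A)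
         (subst (λ m → All (_< m) (x ∷ A)) (+-suc j N) bound) = outside ∷ p , eq
... | inj₂ refl
  with p , eq ← elements-surjective N (suc j) incr x<A
         (subst (λ m → All (_< m) A) (+-suc j N) (All.tail bound)) = inside ∷ p , cong (j ∷_) eq

singleton-⊆ : ∀ j {p : Subset N} {i} → i ∈ₛ p → j + toℕ i ∷ [] ⊆ elements j p
singleton-⊆ j {inside ∷ p}  here rewrite +-identityʳ j = refl ∷ minimum _
singleton-⊆ j {inside ∷ p} {suc i} (there i∈p) rewrite +-suc j (toℕ i) = _ ∷ʳ singleton-⊆ (suc j) i∈p
singleton-⊆ j {outside ∷ p} {suc i} (there i∈p) rewrite +-suc j (toℕ i) = singleton-⊆ (suc j) i∈p

pair-⊆ : ∀ j {p : Subset N} {i i′} → i Fin.< i′ → i ∈ₛ p → i′ ∈ₛ p →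
  j + toℕ i ∷ j + toℕ i′ ∷ [] ⊆ elements j p
pair-⊆ j {inside ∷ p} {zero} {suc i′} _ here (there i′∈p)
  rewrite +-identityʳ j | +-suc j (toℕ i′) = refl ∷ singleton-⊆ (suc j) i′∈p
pair-⊆ j {inside ∷ p} {suc i} {suc i′} (s≤s i<i′) (there i∈p) (there i′∈p)
  rewrite +-suc j (toℕ i) | +-suc j (toℕ i′) = _ ∷ʳ pair-⊆ (suc j) i<i′ i∈p i′∈p
pair-⊆ j {outside ∷ p} {suc i} {suc i′} (s≤s i<i′) (there i∈p) (there i′∈p)
  rewrite +-suc j (toℕ i) | +-suc j (toℕ i′) = pair-⊆ (suc j) i<i′ i∈p i′∈p

subsetsOfSize : (N n : ℕ) → List (Subset N)
subsetsOfSize zero    zero    = [] ∷ []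
subsetsOfSize zero    (suc n) = []
subsetsOfSize (suc N) zero    = map (outside ∷_) (subsetsOfSize N zero)
subsetsOfSize (suc N) (suc n) =
  map (inside ∷_) (subsetsOfSize N n) ++ map (outside ∷_) (subsetsOfSize N (suc n))

∈-subsetsOfSize : (p : Subset N) → ∣ p ∣ ≡ n → p ∈ subsetsOfSize N n
∈-subsetsOfSize {n = zero} []            eq = here refl
∈-subsetsOfSize {n = suc n} (inside ∷ p)  eq =
  ∈-++⁺ˡ (∈-map⁺ (inside ∷_) (∈-subsetsOfSize p (suc-injective eq)))
∈-subsetsOfSize {n = zero}  (outside ∷ p) eq = ∈-map⁺ (outside ∷_) (∈-subsetsOfSize p eq)
∈-subsetsOfSize {suc N} {n = suc n} (outside ∷ p) eq =
  ∈-++⁺ʳ (map (inside ∷_) (subsetsOfSize N n)) (∈-map⁺ (outside ∷_) (∈-subsetsOfSize p eq))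

size-subsetsOfSize : (N n : ℕ) → All (λ p → ∣ p ∣ ≡ n) (subsetsOfSize N n)
size-subsetsOfSize zero    zero    = refl ∷ []
size-subsetsOfSize zero    (suc n) = []
size-subsetsOfSize (suc N) zero    = All-map (size-subsetsOfSize N zero)
size-subsetsOfSize (suc N) (suc n) =
  All-++ (All-map (All.map (cong suc) (size-subsetsOfSize N n))) (All-map (size-subsetsOfSize N (suc n)))

-- Pascal's rule; this crude bound on the binomial coefficient is good enough for the union bound.
length-subsetsOfSize : (N n : ℕ) → length (subsetsOfSize N n) ≤ N ^ n
length-subsetsOfSize zero    zero    = ≤-refl
length-subsetsOfSize zero    (suc n) = z≤n
length-subsetsOfSize (suc N) zero    =
  ≤-trans (≤-reflexive (length-map (outside ∷_) (subsetsOfSize N zero))) (length-subsetsOfSize N zero)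
length-subsetsOfSize (suc N) (suc n) = begin
  length (map (inside ∷_) (subsetsOfSize N n) ++ map (outside ∷_) (subsetsOfSize N (suc n)))
    ≡⟨ length-++ (map (inside ∷_) (subsetsOfSize N n)) ⟩
  length (map (inside ∷_) (subsetsOfSize N n)) + length (map (outside ∷_) (subsetsOfSize N (suc n)))
    ≡⟨ cong₂ _+_ (length-map (inside ∷_) (subsetsOfSize N n))
                 (length-map (outside ∷_) (subsetsOfSize N (suc n))) ⟩
  length (subsetsOfSize N n) + length (subsetsOfSize N (suc n))
    ≤⟨ +-mono-≤ (length-subsetsOfSize N n) (length-subsetsOfSize N (suc n)) ⟩
  suc N * N ^ n
    ≤⟨ *-monoʳ-≤ (suc N) (^-monoˡ-≤ n (n≤1+n N)) ⟩
  suc N ^ suc n ∎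
  where open ≤-Reasoning

-- The union bound

-- An event in the space of `m` coin tosses, given by the tosses it prescribes. Its `completions`
-- are its probability times `2 ^ m`, which keeps the counting in the natural numbers.
PartialAssignment : ℕ → Set
PartialAssignment = Vec (Maybe Bool)

Agrees : Maybe Bool → Bool → Set
Agrees nothing  b = ⊤
Agrees (just c) b = b ≡ c

Extends : ∀ {m} → Vec Bool m → PartialAssignment m → Set
Extends v p = Pointwise Agrees p v

completions : ∀ {m} → PartialAssignment m → ℕ
completions []            = 1
completions (nothing ∷ p) = 2 * completions p
completions (just _ ∷ p)  = completions p

-- Conditioning on the first toss: events prescribing the other value have become impossible and
-- disappear.
restrict : ∀ {m} → Bool → List (PartialAssignment (suc m)) → List (PartialAssignment m)
restrict b []                     = []
restrict b ((nothing ∷ p) ∷ ps) = p ∷ restrict b ps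
restrict b ((just c ∷ p) ∷ ps) with b ≟ᵇ c
... | yes _ = p ∷ restrict b ps
... | no _  = restrict b ps

sum-restrict : ∀ {m} (ps : List (PartialAssignment (suc m))) → sum (map completions ps) ≡
  sum (map completions (restrict true ps)) + sum (map completions (restrict false ps))
sum-restrict [] = refl
sum-restrict ((nothing ∷ p) ∷ ps) rewrite sum-restrict ps = lemma (completions p) _ _
  where
  lemma : ∀ x t f → 2 * x + (t + f) ≡ (x + t) + (x + f)
  lemma = solve-∀
sum-restrict ((just true ∷ p) ∷ ps) rewrite sum-restrict ps = sym (+-assoc (completions p) _ _)
sum-restrict ((just false ∷ p) ∷ ps) rewrite sum-restrict ps =
  lemma (completions p) (sum (map completions (restrict true ps))) _
  where
  lemma : ∀ x t f → x + (t + f) ≡ t + (x + f)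
  lemma = solve-∀

restrict-avoid : ∀ {m b v} (ps : List (PartialAssignment (suc m))) →
  All (λ p → ¬ Extends v p) (restrict b ps) → All (λ p → ¬ Extends (b ∷ v) p) ps
restrict-avoid []                   _          = []
restrict-avoid ((nothing ∷ p) ∷ ps) (¬e ∷ ¬es) = (λ { (_ ∷ e) → ¬e e }) ∷ restrict-avoid ps ¬es
restrict-avoid {b = b} ((just c ∷ p) ∷ ps) ¬es with b ≟ᵇ c
restrict-avoid ((just c ∷ p) ∷ ps) (¬e ∷ ¬es) | yes _  =
  (λ { (_ ∷ e) → ¬e e }) ∷ restrict-avoid ps ¬es
restrict-avoid ((just c ∷ p) ∷ ps) ¬es        | no b≢c =
  (λ { (b≡c ∷ _) → b≢c b≡c }) ∷ restrict-avoid ps ¬es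

-- The method of conditional expectations: fix the coordinates one at a time, keeping
-- the number of completions below the number of remaining assignments.
union-bound : ∀ m (ps : List (PartialAssignment m)) → sum (map completions ps) < 2 ^ m →
  ∃[ v ] All (λ p → ¬ Extends v p) ps
union-bound zero    []         _         = [] , []
union-bound zero    ([] ∷ ps) (s≤s ())
union-bound (suc m) ps         small
  with sum (map completions (restrict true ps)) <? 2 ^ m
... | yes t< with v , ¬es ← union-bound m (restrict true ps) t< = true ∷ v , restrict-avoid ps ¬es
... | no t≮ = let v , ¬es = union-bound m (restrict false ps) f< in false ∷ v , restrict-avoid ps ¬es
  where
  f< : sum (map completions (restrict false ps)) < 2 ^ m
  f< = +-cancelˡ-< (2 ^ m) _ _ (begin-strict
    2 ^ m + sum (map completions (restrict false ps)) ≤⟨ +-monoˡ-≤ _ (≮⇒≥ t≮) ⟩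
    sum (map completions (restrict true ps)) + sum (map completions (restrict false ps)) ≡⟨ sum-restrict ps ⟨
    sum (map completions ps) <⟨ small ⟩
    2 ^ suc m ≡⟨ cong (2 ^ m +_) (+-identityʳ _) ⟩
    2 ^ m + 2 ^ m ∎)
    where open ≤-Reasoning

completions-++ : ∀ {m m′} (p : PartialAssignment m) (p′ : PartialAssignment m′) →
  completions (p ++ᵥ p′) ≡ completions p * completions p′
completions-++ []            p′ = sym (*-identityˡ _)
completions-++ (nothing ∷ p) p′ = trans (cong (2 *_) (completions-++ p p′)) (sym (*-assoc 2 (completions p) _))
completions-++ (just _ ∷ p)  p′ = completions-++ p p′

completions-nothing : ∀ N → completions (Vec.replicate N nothing) ≡ 2 ^ N
completions-nothing zero    = refl
completions-nothing (suc N) = cong (2 *_) (completions-nothing N)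

-- Random graphs

triangular : ℕ → ℕ
triangular zero    = 0
triangular (suc N) = N + triangular N

2*triangular : ∀ n → 2 * triangular (suc n) ≡ suc n * n
2*triangular zero    = refl
2*triangular (suc n) = begin
  2 * (suc n + triangular (suc n))   ≡⟨ *-distribˡ-+ 2 (suc n) (triangular (suc n)) ⟩
  2 * suc n + 2 * triangular (suc n) ≡⟨ cong (2 * suc n +_) (2*triangular n) ⟩
  2 * suc n + suc n * n              ≡⟨ lemma n ⟩
  suc (suc n) * suc n                ∎
  where
  open ≡-Reasoning
  lemma : ∀ n → 2 * suc n + suc n * n ≡ suc (suc n) * suc n
  lemma = solve-∀

star : Bool → Subset N → PartialAssignment N
star b = Vec.map λ s → if s then just b else nothing

-- The event that `p` is a clique of colour `b`. The first coordinates are the edges at the least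
-- vertex, the others those among the later vertices; `edge` reads them in the same order.
clique : Bool → Subset N → PartialAssignment (triangular N)
clique b []            = []
clique b (inside ∷ p)  = star b p ++ᵥ clique b p
clique {suc N} b (outside ∷ p) = Vec.replicate N nothing ++ᵥ clique b p

completions-star : ∀ b (p : Subset N) → completions (star b p) * 2 ^ ∣ p ∣ ≡ 2 ^ N
completions-star b []            = refl
completions-star b (inside ∷ p)  =
  trans (lemma (completions (star b p)) (2 ^ ∣ p ∣)) (cong (2 *_) (completions-star b p))
  where
  lemma : ∀ x y → x * (2 * y) ≡ 2 * (x * y)
  lemma = solve-∀
completions-star b (outside ∷ p) =
  trans (*-assoc 2 (completions (star b p)) _) (cong (2 *_) (completions-star b p))

completions-clique : ∀ b (p : Subset N) →
  completions (clique b p) * 2 ^ triangular ∣ p ∣ ≡ 2 ^ triangular N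
completions-clique b [] = refl
completions-clique {suc N} b (inside ∷ p) = begin
  completions (star b p ++ᵥ clique b p) * 2 ^ (∣ p ∣ + triangular ∣ p ∣)
    ≡⟨ cong₂ _*_ (completions-++ (star b p) (clique b p)) (^-distribˡ-+-* 2 ∣ p ∣ (triangular ∣ p ∣)) ⟩
  (completions (star b p) * completions (clique b p)) * (2 ^ ∣ p ∣ * 2 ^ triangular ∣ p ∣)
    ≡⟨ lemma (completions (star b p)) _ _ _ ⟩
  (completions (star b p) * 2 ^ ∣ p ∣) * (completions (clique b p) * 2 ^ triangular ∣ p ∣)
    ≡⟨ cong₂ _*_ (completions-star b p) (completions-clique b p) ⟩
  2 ^ N * 2 ^ triangular N
    ≡⟨ ^-distribˡ-+-* 2 N (triangular N) ⟨
  2 ^ (N + triangular N) ∎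
  where
  open ≡-Reasoning
  lemma : ∀ x y z w → (x * y) * (z * w) ≡ (x * z) * (y * w)
  lemma = solve-∀
completions-clique {suc N} b (outside ∷ p) = begin
  completions (Vec.replicate N nothing ++ᵥ clique b p) * 2 ^ triangular ∣ p ∣
    ≡⟨ cong (_* 2 ^ triangular ∣ p ∣) (completions-++ (Vec.replicate N nothing) (clique b p)) ⟩
  completions (Vec.replicate N nothing) * completions (clique b p) * 2 ^ triangular ∣ p ∣
    ≡⟨ *-assoc (completions (Vec.replicate N nothing)) _ _ ⟩
  completions (Vec.replicate N nothing) * (completions (clique b p) * 2 ^ triangular ∣ p ∣)
    ≡⟨ cong₂ _*_ (completions-nothing N) (completions-clique b p) ⟩
  2 ^ N * 2 ^ triangular N
    ≡⟨ ^-distribˡ-+-* 2 N (triangular N) ⟨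
  2 ^ (N + triangular N) ∎
  where open ≡-Reasoning

nth : ∀ {m} → Vec Bool m → ℕ → Bool
nth []      _       = false
nth (b ∷ v) zero    = b
nth (b ∷ v) (suc i) = nth v i

edge : ∀ N → Vec Bool (triangular N) → ℕ → ℕ → Bool
edge (suc N) v zero    (suc j) = nth (Vec.take N v) j
edge (suc N) v (suc i) (suc j) = edge N (Vec.drop N v) i j
edge _       _ _       _       = false

extends-nothing : ∀ {m} (v : Vec Bool m) → Extends v (Vec.replicate m nothing)
extends-nothing []      = []
extends-nothing (_ ∷ v) = tt ∷ extends-nothing v

extends-star : ∀ {b} (p : Subset N) v → (∀ {i} → i ∈ₛ p → nth v (toℕ i) ≡ b) → Extends v (star b p)
extends-star []            []      _ = []
extends-star (inside ∷ p)  (x ∷ v) h = h here ∷ extends-star p v (h ∘ there)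
extends-star (outside ∷ p) (x ∷ v) h = tt ∷ extends-star p v (h ∘ there)

extends-clique : ∀ {b} (p : Subset N) v →
  (∀ {i j} → i Fin.< j → i ∈ₛ p → j ∈ₛ p → edge N v (toℕ i) (toℕ j) ≡ b) → Extends v (clique b p)
extends-clique         []            [] h = []
extends-clique {suc N} {b} (s ∷ p) v h =
  subst (λ u → Extends u (clique b (s ∷ p))) (take++drop≡id N v) (split s h)
  where
  IsClique : Bool → Set
  IsClique s = ∀ {i j} → i Fin.< j → i ∈ₛ s ∷ p → j ∈ₛ s ∷ p →
    edge (suc N) v (toℕ i) (toℕ j) ≡ b
  rest : ∀ s → IsClique s → Extends (Vec.drop N v) (clique b p)
  rest s h = extends-clique p (Vec.drop N v) λ i<j i∈p j∈p → h (s≤s i<j) (there i∈p) (there j∈p)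
  split : ∀ s → IsClique s → Extends (Vec.take N v ++ᵥ Vec.drop N v) (clique b (s ∷ p))
  split inside  h = Pointwise.++⁺
    (extends-star p (Vec.take N v) λ i∈p → h (s≤s z≤n) here (there i∈p)) (rest inside h)
  split outside h = Pointwise.++⁺ (extends-nothing (Vec.take N v)) (rest outside h)

edgeColour : ∀ N → Vec Bool (triangular N) → List ℕ → Bool
edgeColour N v (i ∷ j ∷ _) = edge N v i j
edgeColour N v _           = false

sum-completions : ∀ {m x y} {ps : List (PartialAssignment m)} →
  All (λ p → completions p * x ≡ y) ps → sum (map completions ps) * x ≡ length ps * y
sum-completions []                = refl
sum-completions {x = x} {ps = p ∷ ps} (eq ∷ eqs) =
  trans (*-distribʳ-+ x (completions p) _) (cong₂ _+_ eq (sum-completions eqs))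

-- Erdős's probabilistic bound: at most `2 * N ^ n` pairs of an `n`-set and a colour, each a
-- monochromatic clique for a fraction `1 / 2 ^ triangular n` of the colourings.
pairColouring : ∀ N n → 2 * N ^ n < 2 ^ triangular n → Σ[ φ ∈ (List ℕ → Bool) ] Avoids 2 n N φ
pairColouring N n small = edgeColour N v , avoids
  where
  cliques : Bool → List (PartialAssignment (triangular N))
  cliques b = map (clique b) (subsetsOfSize N n)
  events : List (PartialAssignment (triangular N))
  events = cliques true ++ cliques false
  completions-cliques : ∀ b →
    All (λ p → completions p * 2 ^ triangular n ≡ 2 ^ triangular N) (cliques b)
  completions-cliques b = All-map (All.map (λ { {p} refl → completions-clique b p }) (size-subsetsOfSize N n))
  length-events : length events < 2 ^ triangular n
  length-events = begin-strict
    length events ≡⟨ length-++ (cliques true) ⟩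
    length (cliques true) + length (cliques false)
      ≡⟨ cong₂ _+_ (length-map (clique true) (subsetsOfSize N n)) (length-map (clique false) (subsetsOfSize N n)) ⟩
    length (subsetsOfSize N n) + length (subsetsOfSize N n)
      ≤⟨ +-mono-≤ (length-subsetsOfSize N n) (length-subsetsOfSize N n) ⟩
    N ^ n + N ^ n ≡⟨ cong (N ^ n +_) (+-identityʳ (N ^ n)) ⟨
    2 * N ^ n <⟨ small ⟩
    2 ^ triangular n ∎
    where open ≤-Reasoning
  few-completions : sum (map completions events) < 2 ^ triangular N
  few-completions = *-cancelʳ-< (2 ^ triangular n) _ _ (begin-strict
    sum (map completions events) * 2 ^ triangular n
      ≡⟨ sum-completions (All-++ (completions-cliques true) (completions-cliques false)) ⟩
    length events * 2 ^ triangular N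
      <⟨ *-monoˡ-< (2 ^ triangular N) ⦃ m^n≢0 2 (triangular N) ⦄ length-events ⟩
    2 ^ triangular n * 2 ^ triangular N ≡⟨ *-comm (2 ^ triangular n) _ ⟩
    2 ^ triangular N * 2 ^ triangular n ∎)
    where open ≤-Reasoning
  v : Vec Bool (triangular N)
  v = proj₁ (union-bound _ events few-completions)
  ∈-events : ∀ {p} b → p ∈ cliques b → p ∈ events
  ∈-events true  = ∈-++⁺ˡ
  ∈-events false = ∈-++⁺ʳ (cliques true)
  avoids : Avoids 2 n N (edgeColour N v)
  avoids A incr bound c mono with length A <? n
  ... | yes ∣A∣<n = ∣A∣<n
  -- The first `n` points of `A` would already form one of the excluded cliques.
  ... | no ∣A∣≮n
    with p , eq ← elements-surjective N 0 (AllPairs.take⁺ n incr) (All.universal (λ _ → z≤n) _) (All-take n bound)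
    = contradiction
        (extends-clique p v λ {i} {j} i<j i∈p j∈p →
          mono (toℕ i ∷ toℕ j ∷ [])
            (⊆-trans (subst (toℕ i ∷ toℕ j ∷ [] ⊆_) eq (pair-⊆ 0 i<j i∈p j∈p)) (take-⊆ n A)) refl)
        (All.lookup (proj₂ (union-bound _ events few-completions))
          (∈-events c (∈-map⁺ (clique c) (∈-subsetsOfSize p ∣p∣≡n))))
    where
    ∣p∣≡n : ∣ p ∣ ≡ n
    ∣p∣≡n = trans (sym (length-elements 0 p)) (trans (cong length eq) (length-take-≤ n A (≮⇒≥ ∣A∣≮n)))

-- Iterated stepping up

pairColouring-2^ : ∀ q → 0 < q → Σ[ φ ∈ (List ℕ → Bool) ] Avoids 2 (4 * q) (2 ^ q) φ
pairColouring-2^ q@(suc t) _ = pairColouring (2 ^ q) (4 * q) (begin-strict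
  2 * (2 ^ q) ^ (4 * q) ≡⟨ cong (2 *_) (^-*-assoc 2 q (4 * q)) ⟩
  2 ^ suc (q * (4 * q)) <⟨ ^-monoʳ-< 2 (s≤s (s≤s z≤n)) exponents ⟩
  2 ^ triangular (4 * q) ∎)
  where
  open ≤-Reasoning
  -- The second summand is the slack `4q(4q - 1) - 2(1 + 4q²)` at `q = 1 + t`.
  lemma₁ : ∀ t → 2 * suc (suc t * (4 * suc t)) + (2 + 12 * t + 8 * (t * t)) ≡ (4 + 4 * t) * (3 + 4 * t)
  lemma₁ = solve-∀
  lemma₂ : ∀ t → 4 * suc t ≡ 4 + 4 * t
  lemma₂ = solve-∀
  exponents : suc (q * (4 * q)) < triangular (4 * q)
  exponents = *-cancelˡ-< 2 _ _ (begin-strict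
    2 * suc (q * (4 * q)) <⟨ m<m+n _ (s≤s z≤n) ⟩
    2 * suc (q * (4 * q)) + (2 + 12 * t + 8 * (t * t)) ≡⟨ lemma₁ t ⟩
    (4 + 4 * t) * (3 + 4 * t) ≡⟨ 2*triangular (3 + 4 * t) ⟨
    2 * triangular (4 + 4 * t) ≡⟨ cong (λ m → 2 * triangular m) (lemma₂ t) ⟨
    2 * triangular (4 * q) ∎)

trivialColouring : ∀ N → Avoids 2 (suc N) N (λ _ → false)
trivialColouring N A incr bound _ _
  with p , refl ← elements-surjective N 0 incr (All.universal (λ _ → z≤n) A) bound =
  s≤s (subst (_≤ N) (sym (length-elements 0 p)) (∣p∣≤n p))

avoidedSize : ℕ → ℕ → ℕ
avoidedSize a 0                   = a
avoidedSize a 1                   = suc a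
avoidedSize a 2                   = suc a + suc a
avoidedSize a (suc j@(suc (suc _))) = 2 + avoidedSize a j

vertices : ℕ → ℕ → ℕ
vertices q zero    = 2 ^ q
vertices q (suc j) = 2 ^ vertices q j

iteratedColouring : ∀ {a q φ} → 1 ≤ a → Avoids 2 a (2 ^ q) φ → ∀ j →
  Σ[ ψ ∈ (List ℕ → Bool × Bool) ] Avoids (2 + j) (avoidedSize a j) (vertices q j) ψ
iteratedColouring {φ = φ} 1≤a avoids 0 =
  -- Padding by a constant bit, so that all uniformities share the same four colours.
  (λ S → φ S , true) , λ A incr bound c mono →
    avoids A incr bound (proj₁ c) λ S S⊆A ∣S∣≡2 → cong proj₁ (mono S S⊆A ∣S∣≡2)
iteratedColouring 1≤a avoids 1 = _ , stepUpPairs-avoids avoids 1≤a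
iteratedColouring {q = q} 1≤a avoids 2
  with _ , avoids′ ← iteratedColouring {q = q} 1≤a avoids 1 = _ , stepUp-avoids-3 avoids′ (s≤s 1≤a)
iteratedColouring {a = a} {q} 1≤a avoids (suc j@(suc (suc i)))
  with _ , avoids′ ← iteratedColouring {q = q} 1≤a avoids j = _ , stepUp-avoids avoids′ (large i)
  where
  -- The side condition of `stepUp-avoids`: the doubling provides it at uniformity 4, and afterwards
  -- the size grows by 2 while the uniformity grows by 1.
  large : ∀ j → 4 + j ≤ avoidedSize a (2 + j)
  large zero    = +-mono-≤ (s≤s 1≤a) (s≤s 1≤a)
  large (suc j) = s≤s (m≤n⇒m≤1+n (large j))

avoidedSize-≤ : ∀ a j → avoidedSize a j ≤ 2 + 2 * a + 2 * j
avoidedSize-≤ a 0 = ≤-trans (m≤m+n a (2 + a)) (≤-reflexive (lemma a))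
  where
  lemma : ∀ a → a + (2 + a) ≡ 2 + 2 * a + 2 * 0
  lemma = solve-∀
avoidedSize-≤ a 1 = ≤-trans (m≤m+n (suc a) (3 + a)) (≤-reflexive (lemma a))
  where
  lemma : ∀ a → suc a + (3 + a) ≡ 2 + 2 * a + 2 * 1
  lemma = solve-∀
avoidedSize-≤ a 2 = ≤-trans (m≤m+n (suc a + suc a) 4) (≤-reflexive (lemma a))
  where
  lemma : ∀ a → suc a + suc a + 4 ≡ 2 + 2 * a + 2 * 2
  lemma = solve-∀
avoidedSize-≤ a (suc j@(suc (suc _))) = ≤-trans (+-monoʳ-≤ 2 (avoidedSize-≤ a j)) (≤-reflexive (lemma a j))
  where
  lemma : ∀ a j → 2 + (2 + 2 * a + 2 * j) ≡ 2 + 2 * a + 2 * suc j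
  lemma = solve-∀

-- Equality at `j = 2` shows that 5 is the largest starting size that stays below `3k` for all
-- `k = 2 + j`.
avoidedSize-5-≤ : ∀ j → avoidedSize 5 j ≤ 3 * (2 + j)
avoidedSize-5-≤ 0 = ≤ᵇ⇒≤ 5 6 _
avoidedSize-5-≤ 1 = ≤ᵇ⇒≤ 6 9 _
avoidedSize-5-≤ 2 = ≤ᵇ⇒≤ 12 12 _
avoidedSize-5-≤ (suc j@(suc (suc _))) = begin
  2 + avoidedSize 5 j ≤⟨ +-mono-≤ (n≤1+n 2) (avoidedSize-5-≤ j) ⟩
  3 + 3 * (2 + j)     ≡⟨ *-suc 3 (2 + j) ⟨
  3 * (3 + j)         ∎
  where open ≤-Reasoning

-- Below n = 48 no colouring is needed: four vertices and forbidden size five suffice.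
baseColouring : ∀ n → ∃[ a ] ∃[ p ]
  (1 ≤ a × 1 ≤ p × n < 72 * p × (Σ[ φ ∈ (List ℕ → Bool) ] Avoids 2 a (2 ^ suc p) φ)
    × (∀ j → 3 * (2 + j) ≤ n → avoidedSize a j ≤ n))
baseColouring n with n <? 48
... | yes n<48 = 5 , 1 , s≤s z≤n , s≤s z≤n , <-≤-trans n<48 (≤ᵇ⇒≤ 48 72 _)
    , (_ , trivialColouring 4) , λ j → ≤-trans (avoidedSize-5-≤ j)
... | no n≮48 with n / 24 in eq | /-monoˡ-≤ 24 (≮⇒≥ n≮48)
...   | suc zero    | s≤s ()
-- Here `p = q - 1`. Since `n < 24(q + 1)`, and `24(q + 1) ≤ 72(q - 1)` exactly when `q ≥ 2`, this
-- choice yields both the threshold 48 and the constant 72.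
...   | suc (suc t) | _ = 4 * q , suc t , s≤s z≤n , s≤s z≤n , n<72p
    , pairColouring-2^ q (s≤s z≤n) , size
  where
  open ≤-Reasoning
  q = 2 + t
  n<72p : n < 72 * suc t
  n<72p = begin-strict
    n                       ≡⟨ m≡m%n+[m/n]*n n 24 ⟩
    n % 24 + (n / 24) * 24  ≡⟨ cong (λ m → n % 24 + m * 24) {n / 24} {q} eq ⟩
    n % 24 + q * 24         <⟨ +-monoˡ-< (q * 24) (m%n<n n 24) ⟩
    24 + q * 24             ≤⟨ m≤m+n _ (48 * t) ⟩
    24 + q * 24 + 48 * t    ≡⟨ lemma t ⟩
    72 * suc t              ∎
    where
    lemma : ∀ t → 24 + (2 + t) * 24 + 48 * t ≡ 72 * suc t
    lemma = solve-∀
  -- By the choice of 24 the term `2 * (4 * q)` is at most a third of `n`; `3k ≤ n` bounds `2k` by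
  -- the other two thirds.
  size : ∀ j → 3 * (2 + j) ≤ n → avoidedSize (4 * q) j ≤ n
  size j 3k≤n = *-cancelˡ-≤ 3 (begin
    3 * avoidedSize (4 * q) j            ≤⟨ *-monoʳ-≤ 3 (avoidedSize-≤ (4 * q) j) ⟩
    3 * (2 + 2 * (4 * q) + 2 * j)        ≤⟨ m≤m+n _ 6 ⟩
    3 * (2 + 2 * (4 * q) + 2 * j) + 6    ≡⟨ lemma q j ⟩
    q * 24 + 2 * (3 * (2 + j))           ≤⟨ +-mono-≤ 24q≤n (*-monoʳ-≤ 2 3k≤n) ⟩
    n + 2 * n                            ≡⟨⟩
    3 * n                                ∎)
    where
    24q≤n : q * 24 ≤ n
    24q≤n = subst (λ m → m * 24 ≤ n) eq (m/n*n≤m n 24)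
    lemma : ∀ q j → 3 * (2 + 2 * (4 * q) + 2 * j) + 6 ≡ q * 24 + 2 * (3 * (2 + j))
    lemma = solve-∀

-- From colourings of lists to the Ramsey property

encode : Bool × Bool → Fin 4
encode (true  , true)  = zero
encode (true  , false) = suc zero
encode (false , true)  = suc (suc zero)
encode (false , false) = suc (suc (suc zero))

decode : Fin 4 → Bool × Bool
decode zero                   = true , true
decode (suc zero)             = true , false
decode (suc (suc zero))       = false , true
decode (suc (suc (suc zero))) = false , false

decode-encode : ∀ c → decode (encode c) ≡ c
decode-encode (true  , true)  = refl
decode-encode (true  , false) = refl
decode-encode (false , true)  = refl
decode-encode (false , false) = refl

encode-injective : ∀ {c d} → encode c ≡ encode d → c ≡ d
encode-injective {c} {d} eq = trans (sym (decode-encode c)) (trans (cong decode eq) (decode-encode d))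

-- If `r ≤ N`, the colouring restricted to `r` points and read in four of the `ℓ` colours would
-- violate the Ramsey property.
avoids⇒< : ∀ {k n m ℓ N r φ} → Avoids k m N φ →
  m ≤ n → k ≤ n → 4 ≤ ℓ → RamseyProperty k n ℓ r → N < r
avoids⇒< {k} {n} {m} {ℓ} {N} {r} {φ} avoids m≤n k≤n 4≤ℓ ramsey with r ≤? N
... | no r≰N = ≰⇒> r≰N
... | yes r≤N with A , ∣A∣≡n , mono ← ramsey (λ S → inject≤ (encode (φ (elements 0 (proj₁ S)))) 4≤ℓ) =
  contradiction (avoids (elements 0 A) (elements-increasing 0 A)
    (All.map (λ i<r → <-≤-trans i<r r≤N) (elements-< 0 A)) _ monochrome) (≤⇒≯ m≤∣A∣)
  where
  ∣A∣ : length (elements 0 A) ≡ n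
  ∣A∣ = trans (length-elements 0 A) ∣A∣≡n
  m≤∣A∣ : m ≤ length (elements 0 A)
  m≤∣A∣ = ≤-trans m≤n (≤-reflexive (sym ∣A∣))
  -- `Monochromatic` only equates colours; the first `k` elements of `A`, present since `k ≤ n`,
  -- name the common one.
  monochrome : Monochrome k φ (φ (take k (elements 0 A))) (elements 0 A)
  monochrome S S⊆A ∣S∣≡k
    with p , p⊆A , refl ← sublist-elements 0 A S⊆A
    with q , q⊆A , eq ← sublist-elements 0 A (take-⊆ k (elements 0 A)) =
    trans (encode-injective (inject≤-injective 4≤ℓ 4≤ℓ _ _
      (mono (p , trans (sym (length-elements 0 p)) ∣S∣≡k)
            (q , trans (sym (length-elements 0 q)) (trans (cong length eq)
              (length-take-≤ k _ (≤-trans k≤n (≤-reflexive (sym ∣A∣))))))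
            p⊆A q⊆A)))
      (cong φ eq)

-- Lower bounds on the tower function

ℕ⇒ℚ : ℕ → ℚ
ℕ⇒ℚ m = mkℚ (ℤ.+ m) 0 (Coprimality.sym (1-coprimeTo m))

fromℕ≡ : ∀ m → fromℕ m ≡ ℕ⇒ℚ m
fromℕ≡ m = ℚ.normalize-coprime (Coprimality.sym (1-coprimeTo m))

ℕ⇒ℚ-mono-< : ∀ {m n} → m < n → ℕ⇒ℚ m <ℚ ℕ⇒ℚ n
ℕ⇒ℚ-mono-< {m} {n} m<n = *<*
  (subst₂ ℤ._<_ (sym (ℤ.*-identityʳ (ℤ.+ m))) (sym (ℤ.*-identityʳ (ℤ.+ n))) (ℤ.+<+ m<n))

ℕ⇒ℚ-* : ∀ m n → ℕ⇒ℚ m *ℚ ℕ⇒ℚ n ≡ ℕ⇒ℚ (m * n)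
ℕ⇒ℚ-* m n = trans (cong (_/ℚ 1) (sym (ℤ.pos-* m n))) (fromℕ≡ (m * n))

ℕ⇒ℚ-2^ : ∀ m → RawSemiring._^_ +-*-rawSemiring (fromℕ 2) m ≡ ℕ⇒ℚ (2 ^ m)
ℕ⇒ℚ-2^ zero    = refl
ℕ⇒ℚ-2^ (suc m) = trans (cong (fromℕ 2 *ℚ_) (ℕ⇒ℚ-2^ m)) (ℕ⇒ℚ-* 2 (2 ^ m))

2^<ℚ : ∀ p {m} → 2 ^ p < m → 2^ ℕ⇒ℚ p <ℚ ℕ⇒ℚ m
2^<ℚ p {m} 2^p<m = ℕ⇒ℚ-mono-< (≤-<-trans z≤n 2^p<m) ,
  subst₂ _<ℚ_ (sym (ℕ⇒ℚ-2^ p)) (sym (ℚ.*-identityʳ (ℕ⇒ℚ m))) (ℕ⇒ℚ-mono-< 2^p<m)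

1/72 : ℚ
1/72 = ℤ.+ 1 /ℚ 72

1/72*n<p : ∀ n p → n < 72 * p → 1/72 *ℚ fromℕ n <ℚ ℕ⇒ℚ p
1/72*n<p n p n<72p = subst (λ x → 1/72 *ℚ x <ℚ ℕ⇒ℚ p) (sym (fromℕ≡ n)) (ℚ.toℚᵘ-cancel-<
  (ℚᵘ.<-respˡ-≃ (ℚᵘ.≃-sym (ℚ.toℚᵘ-homo-* 1/72 (ℕ⇒ℚ n))) (ℚᵘ.*<* cross)))
  where
  open ℤ.≤-Reasoning
  cross : (ℤ.+ 1 ℤ.* ℤ.+ n) ℤ.* ℤ.+ 1 ℤ.< ℤ.+ p ℤ.* ℤ.+ 72
  cross = begin-strict
    (ℤ.+ 1 ℤ.* ℤ.+ n) ℤ.* ℤ.+ 1 ≡⟨ ℤ.*-identityʳ (ℤ.+ 1 ℤ.* ℤ.+ n) ⟩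
    ℤ.+ 1 ℤ.* ℤ.+ n             ≡⟨ ℤ.*-identityˡ (ℤ.+ n) ⟩
    ℤ.+ n                       <⟨ ℤ.+<+ n<72p ⟩
    ℤ.+ (72 * p)                ≡⟨ cong ℤ.+_ (*-comm 72 p) ⟩
    ℤ.+ (p * 72)                ≡⟨ ℤ.pos-* p 72 ⟩
    ℤ.+ p ℤ.* ℤ.+ 72            ∎

2≤2^ : ∀ {p} → 1 ≤ p → 2 ≤ 2 ^ p
2≤2^ {p} 1≤p = ^-monoʳ-≤ 2 1≤p

2^<-pred : ∀ {p m} → 1 ≤ p → 2 ^ suc p ≤ suc m → 2 ^ p < m
2^<-pred {p} {m} 1≤p 2^1+p≤1+m = ≤-pred (begin
  2 + 2 ^ p          ≤⟨ +-monoˡ-≤ (2 ^ p) (2≤2^ 1≤p) ⟩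
  2 ^ p + 2 ^ p      ≡⟨ cong (2 ^ p +_) (+-identityʳ (2 ^ p)) ⟨
  2 ^ suc p          ≤⟨ 2^1+p≤1+m ⟩
  suc m              ∎)
  where open ≤-Reasoning

2≤vertices : ∀ q j → 1 ≤ q → 2 ≤ vertices q j
2≤vertices q zero    1≤q = 2≤2^ 1≤q
2≤vertices q (suc j) 1≤q = 2≤2^ (≤-trans (n≤1+n 1) (2≤vertices q j 1≤q))

-- Each level needs a rational exponent strictly above the level below. The predecessor of the
-- number of vertices one level down serves, hence the form `suc m`; at the bottom it is `p`, one
-- less than the exponent `suc p` of the vertices.
tower-<-vertices : ∀ {n p} → 1 ≤ p → n < 72 * p → ∀ j m → vertices (suc p) j ≤ suc m →
  tower (2 + j) (fromℚ (1/72 *ℚ fromℕ n)) <ᶜ ℕ⇒ℚ m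
tower-<-vertices {n} {p} 1≤p n<72p zero    m v≤ = ℕ⇒ℚ p , 1/72*n<p n p n<72p , 2^<ℚ p (2^<-pred 1≤p v≤)
tower-<-vertices {n} {p} 1≤p n<72p (suc j) m v≤
  with vertices (suc p) j | 2≤vertices (suc p) j (s≤s z≤n) | tower-<-vertices 1≤p n<72p j
... | suc v | s≤s 1≤v | ih = ℕ⇒ℚ v , ih v ≤-refl , 2^<ℚ v (2^<-pred 1≤v v≤)

tower-<-ramsey : ∀ k .{{_ : NonZero k}} n ℓ → 3 * k ≤ n → 4 ≤ ℓ →
  ∀ r → IsRamseyNumber k n ℓ r → tower k (fromℚ (1/72 *ℚ fromℕ n)) <ᶜ fromℕ r
-- No stepping up: a subset of size `n` forces `n ≤ r`, and `r < 72 * r`.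
tower-<-ramsey 1 n ℓ 3≤n 4≤ℓ r (ramsey , _)
  with A , ∣A∣≡n , _ ← ramsey (λ _ → inject≤ zero 4≤ℓ) =
  subst (1/72 *ℚ fromℕ n <ℚ_) (sym (fromℕ≡ r)) (1/72*n<p n r (begin-strict
    n          ≤⟨ n≤r ⟩
    r          <⟨ m<m+n r (≤-trans 0<r (m≤m+n r (70 * r))) ⟩
    72 * r     ∎))
  where
  open ≤-Reasoning
  n≤r : n ≤ r
  n≤r = ≤-trans (≤-reflexive (sym ∣A∣≡n)) (∣p∣≤n A)
  0<r : 0 < r
  0<r = ≤-trans (s≤s z≤n) (≤-trans 3≤n n≤r)
tower-<-ramsey (suc (suc j)) n ℓ 3k≤n 4≤ℓ r (ramsey , _)
  with a , p , 1≤a , 1≤p , n<72p , (φ , avoids) , size ← baseColouring n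
  with ψ , avoids′ ← iteratedColouring {a} {suc p} 1≤a avoids j =
  subst (tower (2 + j) (fromℚ (1/72 *ℚ fromℕ n)) <ᶜ_) (sym (fromℕ≡ r))
    (tower-<-vertices 1≤p n<72p j r (m≤n⇒m≤1+n (<⇒≤
      (avoids⇒< avoids′ (size j 3k≤n) (≤-trans (m≤n*m (2 + j) 3) 3k≤n) 4≤ℓ ramsey))))

mainTheorem3 : ∃[ c ] (0ℚ <ℚ c
    × (∀ (k : ℕ) .{{_ : NonZero k}} (n ℓ : ℕ) → 3 * k ≤ n → 4 ≤ ℓ →
    ∀ (r : ℕ) → IsRamseyNumber k n ℓ r → tower k (fromℚ (c *ℚ fromℕ n)) <ᶜ fromℕ r)
    × (∀ (k : ℕ) .{{_ : NonZero k}} (n : ℕ) → 3 * k ≤ n →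
    ∀ (r : ℕ) → IsRamseyNumber k n 4 r → tower k (fromℚ (c *ℚ fromℕ n)) <ᶜ fromℕ r))
mainTheorem3 = 1/72 , ℚ.positive⁻¹ 1/72 , tower-<-ramsey ,
  λ k n 3k≤n → tower-<-ramsey k n 4 3k≤n ≤-refl
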